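{- Let $(U,\operatorname{d})$ be a finite nonempty metric space, let $\delta_{\operatorname{d}}\colon 2^U\to\mathbb{R}$ be its maximum linkage function and let $\theta\colon[0,\infty)\to\mathcal{P}(U)$ be the dendogram for single linkage of $(U,\operatorname{d})$. 1. For every real $r\ge 0$ and every block $\mathcal{B}\in\theta(r)$ with $|\mathcal{B}|>1$, the set $$\mathcal{T}:=\{X\subseteq U\mid \delta_{\operatorname{d}}(X)<\exp(-r),\ \mathcal{B}\subseteq X\}$$ is a $\delta_{\operatorname{d}}$-tangle of $U$ of order $\exp(-r)$. 2. For every real $k>0$ and every $\delta_{\operatorname{d}}$-tangle $\mathcal{T}$ of $U$ of order $k$, the number $-\log(k)$ lies in the domain $[0,\infty)$ of $\theta$ and there is a block $\mathcal{B}\in\theta(-\log(k))$ with $|\mathcal{B}|>1$ such that $$\mathcal{T}=\{X\subseteq U\mid \delta_{\operatorname{d}}(X)<k,\ \mathcal{B}\subseteq X\}.$$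
   Context: For $X\subseteq U$ write $\overline{X}=U\setminus X$; $\log$ is the natural logarithm; $\mathcal{P}(U)$ is the set of all partitions of $U$, and the elements of a partition are called blocks (or clusters). The maximum linkage function is defined by $\delta_{\operatorname{d}}(\emptyset)=\delta_{\operatorname{d}}(U)=0$ and $\delta_{\operatorname{d}}(X)=\max_{x\in X,\,x'\in\overline{X}}\exp(-\operatorname{d}(x,x'))$ for all other $X\subseteq U$. For a symmetric set function $\kappa\colon 2^U\to\mathbb{R}$ (i.e. $\kappa(X)=\kappa(\overline{X})$), a $\kappa$-tangle of order $k$ (where $k\ge 0$ is real) is a set $\mathcal{T}\subseteq 2^U$ such that: (T.0) $\kappa(X)<k$ for all $X\in\mathcal{T}$; (T.1) for all $X\subseteq U$ with $\kappa(X)<k$, either $X\in\mathcal{T}$ or $\overline{X}\in\mathcal{T}$; (T.2) $X_1\cap X_2\cap X_3\ne\emptyset$ for all $X_1,X_2,X_3\in\mathcal{T}$; (T.3) $\{x\}\notin\mathcal{T}$ for all $x\in U$. Single linkage dendogram: for nonempty $\mathcal{A},\mathcal{B}\subseteq U$ let $\ell_{SL}(\mathcal{A},\mathcal{B})=\min_{a\in\mathcal{A},b\in\mathcal{B}}\operatorname{d}(a,b)$. Define inductively distances $R_0,\dots,R_m\in[0,\infty)$ and partitions $\Theta_0,\dots,\Theta_m$ of $U$ as follows. $R_0=0$ and $\Theta_0=\{\{x\}\mid x\in U\}$. If $\Theta_i\ne\{U\}$, let $R_{i+1}=\min\{\ell_{SL}(\mathcal{B},\mathcal{B}')\mid \mathcal{B},\mathcal{B}'\in\Theta_i,\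 \mathcal{B}\ne\mathcal{B}'\}$, and let $\Theta_{i+1}$ be obtained from $\Theta_i$ by merging (taking the union of) all blocks in each equivalence class of the relation $\sim_{R_{i+1}}$, where $\mathcal{B}\sim_{R_{i+1}}\mathcal{B}'$ if there are $\mathcal{B}=\mathcal{B}_1,\dots,\mathcal{B}_s=\mathcal{B}'\in\Theta_i$ with $\ell_{SL}(\mathcal{B}_j,\mathcal{B}_{j+1})\le R_{i+1}$ for $j=1,\dots,s-1$. If $\Theta_i=\{U\}$, stop with $m=i$. The dendogram for single linkage is $\theta(r)=\Theta_{i(r)}$, where $i(r)=\max\{i\mid R_i\le r\}$, for $r\in[0,\infty)$. -}

module Defs where

open import Algebra.Bundles using (CommutativeRing; Semiring)
open import Algebra.Core using (Op₁; Op₂)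
import Algebra.Definitions.RawSemiring as RawSemiringDefinitions
open import Algebra.Structures using (IsCommutativeRing)
import Data.Bool.Properties as Bool
open import Data.Fin.Base using (Fin)
open import Data.Fin.Subset using (Subset; ⊤; ⁅_⁆; ∁; _∩_; ⋃; Nonempty)
open import Data.Fin.Subset.Properties using (_∈?_)
open import Data.List.Base
  using (List; []; _∷_; map; filter; deduplicate; cartesianProduct; allFin; upTo; takeWhile; length)
import Data.List.Extrema as Extrema
import Data.List.Extrema.Nat as ℕExtrema
open import Data.List.Membership.Propositional using (_∈_)
import Data.List.Membership.DecPropositional as DecMembership
import Data.List.Properties as List
open import Data.List.Relation.Unary.Any using (here; there)
open import Data.Nat.Base as ℕ using (ℕ; zero; suc)
open import Data.Product.Base using (∃-syntax; _×_; _,_; proj₁; proj₂)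
open import Data.Sum.Base using (_⊎_; inj₁; inj₂)
import Data.Vec.Properties as Vec
open import Function.Metric.Structures using (IsGeneralMetric)
open import Level using (0ℓ)
open import Relation.Binary.Bundles using (DecTotalOrder)
open import Relation.Binary.Construct.Closure.ReflexiveTransitive using (Star; ε; _◅_; _◅◅_)
open import Relation.Binary.Core using (Rel)
open import Relation.Binary.Definitions using (Decidable; DecidableEquality)
import Relation.Binary.Construct.NonStrictToStrict as NonStrictToStrict
open import Relation.Binary.PropositionalEquality.Core using (_≡_; refl)
open import Relation.Binary.Structures using (IsDecTotalOrder)
open import Relation.Nullary.Decidable using (Dec; map′; ¬?; _×-dec_; _⊎-dec_)
open import Relation.Nullary.Negation using (¬_)
open import Relation.Unary using (Pred)

------------------------------------------------------------------------
-- Real numbers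

-- The classical real numbers as a Dedekind-complete ordered field (unique up
-- to isomorphism) with decidable order.  exp and log are pinned down by their
-- definitions: exp x = lim (1 + x/n)ⁿ, and log is the inverse of exp on the
-- positive reals.

record RealNumbers : Set₁ where
  infix  4 _≈_ _≤_
  infixl 6 _+_
  infixl 7 _*_
  infix  8 -_
  infix  9 _⁻¹
  field
    Carrier : Set
    _≈_     : Rel Carrier 0ℓ
    _≤_     : Rel Carrier 0ℓ
    _+_     : Op₂ Carrier
    _*_     : Op₂ Carrier
    -_      : Op₁ Carrier
    0#      : Carrier
    1#      : Carrier
    _⁻¹     : Op₁ Carrier   -- 0# ⁻¹ is unspecified

    isCommutativeRing : IsCommutativeRing _≈_ _+_ _*_ -_ 0# 1#
    isDecTotalOrder   : IsDecTotalOrder _≈_ _≤_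

    0≉1       : ¬ 0# ≈ 1#
    *-inverse : ∀ x → ¬ x ≈ 0# → x * x ⁻¹ ≈ 1#

    +-monoˡ-≤ : ∀ x y z → x ≤ y → x + z ≤ y + z
    *-nonNeg  : ∀ x y → 0# ≤ x → 0# ≤ y → 0# ≤ x * y

  UpperBound : Pred Carrier 0ℓ → Pred Carrier 0ℓ
  UpperBound P b = ∀ x → P x → x ≤ b

  field
    complete : (P : Pred Carrier 0ℓ) → ∃[ x ] P x → ∃[ b ] UpperBound P b →
               ∃[ s ] (UpperBound P s × (∀ b → UpperBound P b → s ≤ b))

  commutativeRing : CommutativeRing 0ℓ 0ℓ
  commutativeRing = record { isCommutativeRing = isCommutativeRing }

  decTotalOrder : DecTotalOrder 0ℓ 0ℓ 0ℓ
  decTotalOrder = record { isDecTotalOrder = isDecTotalOrder }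

  open NonStrictToStrict _≈_ _≤_ public using (_<_)
  open IsDecTotalOrder isDecTotalOrder public using (_≤?_)
  open CommutativeRing commutativeRing public using (_-_)
  open RawSemiringDefinitions (Semiring.rawSemiring (CommutativeRing.semiring commutativeRing)) public
    using (_^_) renaming (_×_ to _·_)

  _⟶_ : (ℕ → Carrier) → Carrier → Set
  a ⟶ l = ∀ ε → 0# < ε → ∃[ N ] (∀ n → N ℕ.≤ n → (l - ε < a n) × (a n < l + ε))

  field
    exp     : Carrier → Carrier
    exp-lim : ∀ x → (λ n → (1# + x * (n · 1#) ⁻¹) ^ n) ⟶ exp x

    log     : ∀ k → 0# < k → Carrier
    exp-log : ∀ k (k>0 : 0# < k) → exp (log k k>0) ≈ k

  private
    module Ext = Extrema (DecTotalOrder.totalOrder decTotalOrder)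

  -- The value 0# on the empty list is the convention δ(∅) = δ(U) = 0 for
  -- maximum; for minimum it is junk.

  maximum : List Carrier → Carrier
  maximum []       = 0#
  maximum (x ∷ xs) = Ext.max x xs

  minimum : List Carrier → Carrier
  minimum []       = 0#
  minimum (x ∷ xs) = Ext.min x xs

------------------------------------------------------------------------
-- Decidability of reachability inside a finite list

module Reachability {A : Set} (_≟_ : DecidableEquality A)
                    {E : Rel A 0ℓ} (E? : Decidable E) where

  open DecMembership _≟_ using () renaming (_∈?_ to _∈ᴸ?_)

  Edge : List A → Rel A 0ℓ
  Edge vs x y = x ∈ vs × y ∈ vs × E x y

  private

    Edge? : ∀ vs → Decidable (Edge vs)
    Edge? vs x y = (x ∈ᴸ? vs) ×-dec (y ∈ᴸ? vs) ×-dec E? x y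

    module _ (vs : List A) where

      -- Paths all of whose interior vertices lie in ws (Warshall).
      Via : List A → Rel A 0ℓ
      Via []       x y = x ≡ y ⊎ Edge vs x y
      Via (w ∷ ws) x y = Via ws x y ⊎ (Via ws x w × Via ws w y)

      via? : ∀ ws → Decidable (Via ws)
      via? []       x y = (x ≟ y) ⊎-dec Edge? vs x y
      via? (w ∷ ws) x y = via? ws x y ⊎-dec (via? ws x w ×-dec via? ws w y)

      via-base : ∀ ws {x y} → Via [] x y → Via ws x y
      via-base []       p = p
      via-base (w ∷ ws) p = inj₁ (via-base ws p)

      via-trans : ∀ ws {x y z} → z ∈ ws → Via ws x z → Via ws z y → Via ws x y
      via-trans (w ∷ ws) (here refl) p q = inj₂ (to p , from q)
        where
        to : ∀ {x} → Via (w ∷ ws) x w → Via ws x w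
        to (inj₁ p)       = p
        to (inj₂ (p , _)) = p
        from : ∀ {y} → Via (w ∷ ws) w y → Via ws w y
        from (inj₁ q)       = q
        from (inj₂ (_ , q)) = q
      via-trans (w ∷ ws) (there i) (inj₁ p)        (inj₁ q)        = inj₁ (via-trans ws i p q)
      via-trans (w ∷ ws) (there i) (inj₁ p)        (inj₂ (q , q′)) = inj₂ (via-trans ws i p q , q′)
      via-trans (w ∷ ws) (there i) (inj₂ (p , p′)) (inj₁ q)        = inj₂ (p , via-trans ws i p′ q)
      via-trans (w ∷ ws) (there i) (inj₂ (p , _))  (inj₂ (_ , q))  = inj₂ (p , q)

      via⇒star : ∀ ws {x y} → Via ws x y → Star (Edge vs) x y
      via⇒star []       (inj₁ refl)    = ε
      via⇒star []       (inj₂ e)       = e ◅ ε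
      via⇒star (w ∷ ws) (inj₁ p)       = via⇒star ws p
      via⇒star (w ∷ ws) (inj₂ (p , q)) = via⇒star ws p ◅◅ via⇒star ws q

      star⇒via : ∀ {x y} → Star (Edge vs) x y → Via vs x y
      star⇒via ε        = via-base vs (inj₁ refl)
      star⇒via (e ◅ es) = via-trans vs (proj₁ (proj₂ e)) (via-base vs (inj₂ e)) (star⇒via es)

  reachable? : ∀ vs → Decidable (Star (Edge vs))
  reachable? vs x y = map′ (via⇒star vs vs) (star⇒via vs) (via? vs vs x y)

------------------------------------------------------------------------
-- Subsets of Fin n

_≟ˢ_ : ∀ {n} → DecidableEquality (Subset n)
_≟ˢ_ = Vec.≡-dec Bool._≟_

elements : ∀ {n} → Subset n → List (Fin n)
elements X = filter (_∈? X) (allFin _)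

module _ (ℝ : RealNumbers) where

  open RealNumbers ℝ

  IsMetric : ∀ {n} → (Fin n → Fin n → Carrier) → Set
  IsMetric = IsGeneralMetric _≡_ _≈_ _≤_ 0# _+_

------------------------------------------------------------------------
-- Tangles

  record IsTangle {n : ℕ} (κ : Subset n → Carrier) (k : Carrier)
                  (𝒯 : Pred (Subset n) 0ℓ) : Set where
    field
      symmetric : ∀ X → κ X ≈ κ (∁ X)
      k≥0       : 0# ≤ k
      T0 : ∀ X → 𝒯 X → κ X < k
      T1 : ∀ X → κ X < k → 𝒯 X ⊎ 𝒯 (∁ X)
      T2 : ∀ X₁ X₂ X₃ → 𝒯 X₁ → 𝒯 X₂ → 𝒯 X₃ → Nonempty (X₁ ∩ X₂ ∩ X₃)
      T3 : ∀ x → ¬ 𝒯 ⁅ x ⁆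

  module _ {n : ℕ} (d : Fin n → Fin n → Carrier) where

------------------------------------------------------------------------
-- Maximum linkage

    maximumLinkage : Subset n → Carrier
    maximumLinkage X =
      maximum (map (λ (x , x′) → exp (- d x x′))
                   (cartesianProduct (elements X) (elements (∁ X))))

------------------------------------------------------------------------
-- Single linkage

    -- A partition is given by the duplicate-free list of its blocks.
    Partition : Set
    Partition = List (Subset n)

    ℓSL : Subset n → Subset n → Carrier
    ℓSL A B = minimum (map (λ (a , b) → d a b) (cartesianProduct (elements A) (elements B)))

    module _ (r : Carrier) where

      open Reachability _≟ˢ_ (λ A B → ℓSL A B ≤? r)

      -- For blocks B and B′ of Θ, Chain Θ B B′ is the relation B ∼ᵣ B′.
      Chain : Partition → Rel (Subset n) 0ℓ
      Chain Θ = Star (Edge Θ)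

      chain? : ∀ Θ → Decidable (Chain Θ)
      chain? = reachable?

      merge : Partition → Partition
      merge Θ = deduplicate _≟ˢ_ (map (λ B → ⋃ (filter (chain? Θ B) Θ)) Θ)

    nextDistance : Partition → Carrier
    nextDistance Θ =
      minimum (map (λ (B , B′) → ℓSL B B′)
                   (filter (λ (B , B′) → ¬? (B ≟ˢ B′)) (cartesianProduct Θ Θ)))

    -- Only the values at indices up to lastIndex belong to the construction.

    Θ : ℕ → Partition
    Θ zero    = map ⁅_⁆ (allFin n)
    Θ (suc i) = merge (nextDistance (Θ i)) (Θ i)

    R : ℕ → Carrier
    R zero    = 0#
    R (suc i) = nextDistance (Θ i)

    IsTrivial : Partition → Set
    IsTrivial Π = Π ≡ ⊤ ∷ []

    isTrivial? : ∀ Π → Dec (IsTrivial Π)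
    isTrivial? Π = List.≡-dec _≟ˢ_ Π (⊤ ∷ [])

    -- The least m with Θ m = {U}.  Every step up to m decreases the
    -- number of blocks, so m < n when n is nonzero.
    lastIndex : ℕ
    lastIndex = length (takeWhile (λ i → ¬? (isTrivial? (Θ i))) (upTo n))

    -- The default 0 is a genuine candidate, as R 0 = 0 ≤ r.
    index : Carrier → ℕ
    index r = ℕExtrema.max 0 (filter (λ i → R i ≤? r) (upTo (suc lastIndex)))

    dendrogram : (r : Carrier) → 0# ≤ r → Partition
    dendrogram r _ = Θ (index r)

{-# OPTIONS --safe #-}

-- For r ≥ 0 the blocks of the single linkage partition at r are the components
-- of the graph on U whose edges are the pairs at distance at most r: merging
-- along chains of blocks preserves this, and between consecutive merge
-- distances no new edge joins two blocks.  On the other hand δ(X) < exp(-r) says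
-- exactly that no edge of this graph leaves X.  A component with more than one
-- point therefore induces a tangle.  Conversely, sets without leaving edges are
-- closed under intersection, hence so is a tangle; were the complements of all
-- components in it, so would be their intersection ∅.  Thus some component is
-- in the tangle, and it determines the tangle.

module Submission where

open import Algebra.Bundles using (CommutativeRing)
import Algebra.Properties.CommutativeSemiring.Exp as Exponentiation
import Algebra.Properties.Ring as RingProperties
import Algebra.Properties.Semiring.Mult as Multiplication
open import Data.Fin.Base using (Fin; fromℕ<)
open import Data.Fin.Subset using (Subset; _⊆_; ∣_∣; ⊤; ⁅_⁆; ∁; _∩_; ⋃; Nonempty)
  renaming (_∈_ to _∈ˢ_; _∉_ to _∉ˢ_)
open import Data.Fin.Subset.Properties
  using (_∈?_; ∈⊤; ∉⊥; ⊆⊤; ⊆-antisym; x∈⁅x⁆; x∈⁅y⁆⇒x≡y; ∣⁅x⁆∣≡1; p⊆q⇒∣p∣≤∣q∣; p⊂q⇒∣p∣<∣q∣;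
         x∈p⇒x∉∁p; x∈∁p⇒x∉p; x∉∁p⇒x∈p; x∉p⇒x∈∁p; p∩q⊆p; p∩q⊆q; x∈p∩q⁺; x∈p∩q⁻; x∈p∪q⁺; x∈p∪q⁻)
open import Data.List.Base
  using ([]; _∷_; map; filter; deduplicate; cartesianProduct; allFin; applyUpTo; upTo; takeWhile; length)
import Data.List.Extrema as Extrema
import Data.List.Extrema.Nat as ℕExtrema
open import Data.List.Membership.Propositional using (_∈_)
open import Data.List.Membership.Propositional.Properties
  using (∈-filter⁺; ∈-filter⁻; ∈-allFin; ∈-map⁺; ∈-map⁻; ∈-cartesianProduct⁺; ∈-cartesianProduct⁻;
         ∈-deduplicate⁺; ∈-deduplicate⁻; ∈-upTo⁺; ∈-upTo⁻)
open import Data.List.Properties using (filter-notAll; length-filter; length-deduplicate; length-map; length-tabulate)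
open import Data.List.Relation.Unary.All as All using (_∷_)
open import Data.List.Relation.Unary.AllPairs using ([]; _∷_)
open import Data.List.Relation.Unary.Any as Any using (here; there)
open import Data.List.Relation.Unary.Unique.DecPropositional.Properties using (deduplicate-!)
open import Data.List.Relation.Unary.Unique.Propositional using (Unique)
import Data.List.Relation.Unary.Unique.Propositional.Properties as Unique
open import Data.Nat.Base as ℕ using (ℕ; zero; suc; NonZero)
import Data.Nat.Properties as ℕ
open import Data.Product.Base using (Σ-syntax; ∃-syntax; _×_; _,_; proj₁; proj₂)
open import Data.Sum.Base using (_⊎_; inj₁; inj₂)
open import Function.Base using (_∘_; id)
open import Function.Metric.Structures using (IsGeneralMetric)
open import Level using (0ℓ)
open import Relation.Binary.Bundles using (DecTotalOrder)
open import Relation.Binary.Construct.Closure.ReflexiveTransitive as Star using (Star; ε; _◅_; _◅◅_)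
import Relation.Binary.Construct.NonStrictToStrict as NonStrictToStrict
open import Relation.Binary.Definitions using (DecidableEquality)
open import Relation.Binary.PropositionalEquality using (_≡_; _≢_; refl; sym; trans; cong; subst)
import Relation.Binary.Reasoning.PartialOrder as PartialOrderReasoning
open import Relation.Nullary.Decidable using (yes; no; ¬?; decidable-stable)
open import Relation.Nullary.Negation using (¬_; contradiction)
open import Relation.Unary using (Pred; Decidable; _≐_)
open import Defs

-- The exponential function

module Exponential (ℝ : RealNumbers) where

  open RealNumbers ℝ
  open CommutativeRing commutativeRing using
    (+-cong; +-congˡ; +-congʳ; +-assoc; +-comm; +-identityˡ; +-identityʳ; -‿inverseˡ; -‿inverseʳ;
     *-congˡ; *-congʳ; *-assoc; *-comm; *-identityˡ; *-identityʳ; distribˡ; distribʳ; zeroˡ; zeroʳ;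
     ring; semiring; commutativeSemiring)
  open DecTotalOrder decTotalOrder using (poset; total; antisym; reflexive; module Eq)
    renaming (refl to ≤-refl; trans to ≤-trans; ≤-respʳ-≈ to ≤-respʳ; ≤-respˡ-≈ to ≤-respˡ)
  open PartialOrderReasoning poset
  open RingProperties ring using (-‿distribˡ-*; -‿distribʳ-*; -‿involutive)
    renaming (//-rightDividesˡ to x-y+y≈x; //-rightDividesʳ to x+y-y≈x)
  open Multiplication semiring using (×-congʳ; ×-congˡ; ×-comm-*; ×-assoc-*; ×-assocˡ)
  open Exponentiation commutativeSemiring using (^-congˡ; ^-assocʳ; ^-distrib-*)

  private
    variable
      w x y z : Carrier

  -- Arithmetic of ordered fields

  <⇒≱ : x < y → ¬ y ≤ x
  <⇒≱ = NonStrictToStrict.<⇒≱ _≈_ _≤_ antisym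

  ≰⇒> : ¬ x ≤ y → y < x
  ≰⇒> = NonStrictToStrict.≰⇒> _≈_ _≤_ Eq.sym reflexive total

  <-respʳ : x ≈ y → z < x → z < y
  <-respʳ = NonStrictToStrict.<-respʳ-≈ _≈_ _≤_ Eq.sym Eq.trans ≤-respʳ

  +-monoʳ-≤ : ∀ z → x ≤ y → z + x ≤ z + y
  +-monoʳ-≤ {x} {y} z x≤y = begin
    z + x  ≈⟨ +-comm z x ⟩
    x + z  ≤⟨ +-monoˡ-≤ x y z x≤y ⟩
    y + z  ≈⟨ +-comm y z ⟩
    z + y  ∎

  +-mono-≤ : w ≤ x → y ≤ z → w + y ≤ x + z
  +-mono-≤ w≤x y≤z = ≤-trans (+-monoˡ-≤ _ _ _ w≤x) (+-monoʳ-≤ _ y≤z)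

  +-cancelʳ-≤ : ∀ z → x + z ≤ y + z → x ≤ y
  +-cancelʳ-≤ {x} {y} z p = begin
    x          ≈⟨ x+y-y≈x z x ⟨
    x + z - z  ≤⟨ +-monoˡ-≤ _ _ _ p ⟩
    y + z - z  ≈⟨ x+y-y≈x z y ⟩
    y          ∎

  +-monoˡ-< : ∀ z → x < y → x + z < y + z
  +-monoˡ-< z x<y = ≰⇒> (<⇒≱ x<y ∘ +-cancelʳ-≤ z)

  +-monoʳ-< : ∀ z → x < y → z + x < z + y
  +-monoʳ-< {x} {y} z x<y = begin-strict
    z + x  ≈⟨ +-comm z x ⟩
    x + z  <⟨ +-monoˡ-< z x<y ⟩
    y + z  ≈⟨ +-comm y z ⟩
    z + y  ∎

  x≤y⇒0≤y-x : x ≤ y → 0# ≤ y - x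
  x≤y⇒0≤y-x {x} {y} x≤y = begin
    0#     ≈⟨ -‿inverseʳ x ⟨
    x - x  ≤⟨ +-monoˡ-≤ _ _ _ x≤y ⟩
    y - x  ∎

  x<y⇒0<y-x : x < y → 0# < y - x
  x<y⇒0<y-x {x} {y} x<y = begin-strict
    0#     ≈⟨ -‿inverseʳ x ⟨
    x - x  <⟨ +-monoˡ-< _ x<y ⟩
    y - x  ∎

  0≤y-x⇒x≤y : 0# ≤ y - x → x ≤ y
  0≤y-x⇒x≤y {y} {x} p = begin
    x          ≈⟨ +-identityˡ x ⟨
    0# + x     ≤⟨ +-monoˡ-≤ _ _ _ p ⟩
    y - x + x  ≈⟨ x-y+y≈x x y ⟩
    y          ∎

  neg-mono-≤ : x ≤ y → - y ≤ - x
  neg-mono-≤ {x} {y} x≤y = 0≤y-x⇒x≤y (begin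
    0#           ≤⟨ x≤y⇒0≤y-x x≤y ⟩
    y - x        ≈⟨ +-comm y (- x) ⟩
    - x + y      ≈⟨ +-congˡ (-‿involutive y) ⟨
    - x - (- y)  ∎)

  neg-cancel-≤ : - y ≤ - x → x ≤ y
  neg-cancel-≤ {y} {x} p = begin
    x      ≈⟨ -‿involutive x ⟨
    - - x  ≤⟨ neg-mono-≤ p ⟩
    - - y  ≈⟨ -‿involutive y ⟩
    y      ∎

  neg-mono-< : x < y → - y < - x
  neg-mono-< x<y = ≰⇒> (<⇒≱ x<y ∘ neg-cancel-≤)

  -x≤0 : 0# ≤ x → - x ≤ 0#
  -x≤0 {x} 0≤x = 0≤y-x⇒x≤y (begin
    0#          ≤⟨ 0≤x ⟩
    x           ≈⟨ -‿involutive x ⟨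
    - - x       ≈⟨ +-identityˡ _ ⟨
    0# - (- x)  ∎)

  *-monoˡ-≤ : 0# ≤ z → x ≤ y → z * x ≤ z * y
  *-monoˡ-≤ {z} {x} {y} 0≤z x≤y = 0≤y-x⇒x≤y (begin
    0#               ≤⟨ *-nonNeg _ _ 0≤z (x≤y⇒0≤y-x x≤y) ⟩
    z * (y - x)      ≈⟨ distribˡ z y (- x) ⟩
    z * y + z * - x  ≈⟨ +-congˡ (-‿distribʳ-* z x) ⟨
    z * y - z * x    ∎)

  *-monoʳ-≤ : 0# ≤ z → x ≤ y → x * z ≤ y * z
  *-monoʳ-≤ {z} {x} {y} 0≤z x≤y = begin
    x * z  ≈⟨ *-comm x z ⟩
    z * x  ≤⟨ *-monoˡ-≤ 0≤z x≤y ⟩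
    z * y  ≈⟨ *-comm z y ⟩
    y * z  ∎

  *-mono-≤ : 0# ≤ w → w ≤ x → 0# ≤ y → y ≤ z → w * y ≤ x * z
  *-mono-≤ 0≤w w≤x 0≤y y≤z =
    ≤-trans (*-monoʳ-≤ 0≤y w≤x) (*-monoˡ-≤ (≤-trans 0≤w w≤x) y≤z)

  x*x≥0 : ∀ x → 0# ≤ x * x
  x*x≥0 x with total 0# x
  ... | inj₁ 0≤x = *-nonNeg x x 0≤x 0≤x
  ... | inj₂ x≤0 = begin
    0#           ≤⟨ *-nonNeg _ _ 0≤-x 0≤-x ⟩
    - x * - x    ≈⟨ -‿distribˡ-* x (- x) ⟨
    - (x * - x)  ≈⟨ -‿distribʳ-* x (- x) ⟩
    x * - - x    ≈⟨ *-congˡ (-‿involutive x) ⟩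
    x * x        ∎
    where
    0≤-x : 0# ≤ - x
    0≤-x = ≤-respʳ (+-identityˡ (- x)) (x≤y⇒0≤y-x x≤0)

  0<1 : 0# < 1#
  0<1 = ≤-respʳ (*-identityˡ 1#) (x*x≥0 1#) , 0≉1

  *-pos : 0# < x → 0# < y → 0# < x * y
  *-pos {x} {y} (0≤x , 0≉x) (0≤y , 0≉y) = *-nonNeg x y 0≤x 0≤y , λ 0≈xy → 0≉y (begin-equality
    0#              ≈⟨ zeroˡ (x ⁻¹) ⟨
    0# * x ⁻¹       ≈⟨ *-congʳ 0≈xy ⟩
    x * y * x ⁻¹    ≈⟨ *-comm (x * y) (x ⁻¹) ⟩
    x ⁻¹ * (x * y)  ≈⟨ *-assoc (x ⁻¹) x y ⟨
    x ⁻¹ * x * y    ≈⟨ *-congʳ (*-comm (x ⁻¹) x) ⟩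
    x * x ⁻¹ * y    ≈⟨ *-congʳ (*-inverse x (0≉x ∘ Eq.sym)) ⟩
    1# * y          ≈⟨ *-identityˡ y ⟩
    y               ∎)

  -- Multiplying `x ⁻¹ ≤ 0#` by the positive `x` would give `1# ≤ 0#`.
  ⁻¹-pos : 0# < x → 0# < x ⁻¹
  ⁻¹-pos {x} (0≤x , 0≉x) = ≰⇒> λ x⁻¹≤0 → <⇒≱ 0<1 (begin
    1#        ≈⟨ *-inverse x (0≉x ∘ Eq.sym) ⟨
    x * x ⁻¹  ≤⟨ *-monoˡ-≤ 0≤x x⁻¹≤0 ⟩
    x * 0#    ≈⟨ zeroʳ x ⟩
    0#        ∎)

  1≤1+x : 0# ≤ x → 1# ≤ 1# + x
  1≤1+x {x} 0≤x = ≤-respˡ (+-identityʳ 1#) (+-monoʳ-≤ 1# 0≤x)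

  -- Natural multiples and powers

  ·-nonNeg : ∀ n → 0# ≤ x → 0# ≤ n · x
  ·-nonNeg zero    0≤x = ≤-refl
  ·-nonNeg (suc n) 0≤x = ≤-respˡ (+-identityˡ 0#) (+-mono-≤ 0≤x (·-nonNeg n 0≤x))

  ·1-mono-≤ : ∀ {m n} → m ℕ.≤ n → m · 1# ≤ n · 1#
  ·1-mono-≤ {n = n} ℕ.z≤n = ·-nonNeg n (proj₁ 0<1)
  ·1-mono-≤ (ℕ.s≤s m≤n)   = +-monoʳ-≤ 1# (·1-mono-≤ m≤n)

  ·1-pos : ∀ n → 0# < suc n · 1#
  ·1-pos n = begin-strict
    0#          <⟨ 0<1 ⟩
    1#          ≤⟨ 1≤1+x (·-nonNeg n (proj₁ 0<1)) ⟩
    suc n · 1#  ∎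

  ·≈·1* : ∀ n x → n · x ≈ n · 1# * x
  ·≈·1* n x = Eq.sym (Eq.trans (×-assoc-* n 1# x) (×-congʳ n (*-identityˡ x)))

  ·-cancel : ∀ n → suc n · x ≈ suc n · y → x ≈ y
  ·-cancel {x} {y} n p = begin-equality
    x                ≈⟨ undo x ⟨
    ν ⁻¹ * suc n · x  ≈⟨ *-congˡ p ⟩
    ν ⁻¹ * suc n · y  ≈⟨ undo y ⟩
    y                ∎
    where
    ν = suc n · 1#
    undo : ∀ z → ν ⁻¹ * (suc n · z) ≈ z
    undo z = begin-equality
      ν ⁻¹ * suc n · z  ≈⟨ *-congˡ (·≈·1* (suc n) z) ⟩
      ν ⁻¹ * (ν * z)   ≈⟨ *-assoc (ν ⁻¹) ν z ⟨
      ν ⁻¹ * ν * z     ≈⟨ *-congʳ (*-comm (ν ⁻¹) ν) ⟩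
      ν * ν ⁻¹ * z     ≈⟨ *-congʳ (*-inverse ν (proj₂ (·1-pos n) ∘ Eq.sym)) ⟩
      1# * z           ≈⟨ *-identityˡ z ⟩
      z                ∎

  ^-nonNeg : ∀ n → 0# ≤ x → 0# ≤ x ^ n
  ^-nonNeg zero    0≤x = proj₁ 0<1
  ^-nonNeg (suc n) 0≤x = *-nonNeg _ _ 0≤x (^-nonNeg n 0≤x)

  ^-pos : ∀ n → 0# < x → 0# < x ^ n
  ^-pos zero    0<x = 0<1
  ^-pos (suc n) 0<x = *-pos 0<x (^-pos n 0<x)

  ^-mono-≤ : ∀ n → 0# ≤ x → x ≤ y → x ^ n ≤ y ^ n
  ^-mono-≤ zero    0≤x x≤y = ≤-refl
  ^-mono-≤ (suc n) 0≤x x≤y = *-mono-≤ 0≤x x≤y (^-nonNeg n 0≤x) (^-mono-≤ n 0≤x x≤y)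

  bernoulli : ∀ n → 0# ≤ 1# + x → 1# + n · x ≤ (1# + x) ^ n
  bernoulli zero    0≤1+x = reflexive (+-identityʳ 1#)
  bernoulli {x} (suc n) 0≤1+x = begin
    1# + (x + n · x)                  ≈⟨ +-congˡ (+-comm x (n · x)) ⟩
    1# + (n · x + x)                  ≈⟨ +-assoc 1# (n · x) x ⟨
    1# + n · x + x                    ≈⟨ +-identityʳ _ ⟨
    -- The added `n · (x * x)` is exactly the excess of `(1# + x) * (1# + n · x)` over
    -- `1# + suc n · x`.
    1# + n · x + x + 0#               ≤⟨ +-monoʳ-≤ _ (·-nonNeg n (x*x≥0 x)) ⟩
    1# + n · x + x + n · (x * x)      ≈⟨ +-congˡ (×-comm-* n x x) ⟨
    1# + n · x + x + x * n · x        ≈⟨ +-assoc _ x _ ⟩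
    1# + n · x + (x + x * n · x)      ≈⟨ +-congˡ (+-congʳ (*-identityʳ x)) ⟨
    1# + n · x + (x * 1# + x * n · x) ≈⟨ +-cong (*-identityˡ _) (distribˡ x 1# (n · x)) ⟨
    1# * (1# + n · x) + x * (1# + n · x) ≈⟨ distribʳ (1# + n · x) 1# x ⟨
    (1# + x) * (1# + n · x)           ≤⟨ *-monoˡ-≤ 0≤1+x (bernoulli n 0≤1+x) ⟩
    (1# + x) * (1# + x) ^ n           ∎

  -- Completeness yields no bound for x, only the absurdity of there being none.
  archimedean : ∀ x → ¬ (∀ n → n · 1# ≤ x)
  archimedean x bound with complete (λ y → ∃[ n ] y ≈ n · 1#) (0# , 0 , Eq.refl)
                             (x , λ { y (n , y≈n) → ≤-respˡ (Eq.sym y≈n) (bound n) })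
  ... | s , ub , least = <⇒≱ s-1<s (least (s - 1#) λ { y (n , y≈n) → +-cancelʳ-≤ 1# (begin
      y + 1#       ≈⟨ +-congʳ y≈n ⟩
      n · 1# + 1#  ≈⟨ +-comm _ 1# ⟩
      suc n · 1#   ≤⟨ ub _ (suc n , Eq.refl) ⟩
      s            ≈⟨ x-y+y≈x 1# s ⟨
      s - 1# + 1#  ∎) })
    where
    s-1<s : s - 1# < s
    s-1<s = begin-strict
      s - 1#       ≈⟨ +-identityʳ _ ⟨
      s - 1# + 0#  <⟨ +-monoʳ-< _ 0<1 ⟩
      s - 1# + 1#  ≈⟨ x-y+y≈x 1# s ⟩
      s            ∎

  -- Doubly negated because `archimedean` only refutes a bound. This suffices for proving
  -- inequalities, which are stable as the order is decidable. The form `suc n` keeps later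
  -- denominators nonzero.
  ¬¬-large : ∀ x → ¬ ¬ (∃[ n ] 0# < suc n · 1# + x)
  ¬¬-large x none = archimedean (- x) bound
    where
    bound : ∀ n → n · 1# ≤ - x
    bound n with n · 1# ≤? - x
    ... | yes p = p
    ... | no ¬p = contradiction (n , (begin-strict
      0#              ≈⟨ -‿inverseˡ x ⟨
      - x + x         <⟨ +-monoˡ-< x (≰⇒> ¬p) ⟩
      n · 1# + x      ≤⟨ +-monoˡ-≤ _ _ x (·1-mono-≤ (ℕ.n≤1+n n)) ⟩
      suc n · 1# + x  ∎)) none

  -- Comparison of limits

  Frequently : (ℕ → Set) → Set
  Frequently P = ∀ m → ∃[ n ] (m ℕ.≤ n × P n)

  -- Otherwise let `η` be half of `x + e - y`. At an index where both sequences are within `η` of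
  -- their limits, `x - η + e < a n + e ≤ b n < y + η`, which contradicts the choice of `η`.
  -- Infinitely many indices suffice, and the estimates below are proved only along the multiples of
  -- a fixed index. The constant `e` carries a strict gap to the limit.
  ⟶-mono-≤ : ∀ {a b} e → a ⟶ x → b ⟶ y → Frequently (λ n → a n + e ≤ b n) → x + e ≤ y
  ⟶-mono-≤ {x} {y} {a} {b} e a⟶x b⟶y often with (x + e) ≤? y
  ... | yes p = p
  ... | no ¬p = contradiction (begin
    x + e              ≈⟨ x+y-y≈x η _ ⟨
    x + e + η - η      ≈⟨ +-assoc (x + e) η (- η) ⟩
    x + e + (η - η)    ≈⟨ +-congˡ (+-comm η (- η)) ⟩
    x + e + (- η + η)  ≈⟨ +-assoc (x + e) (- η) η ⟨
    x + e - η + η      ≈⟨ +-congʳ (+-assoc x e (- η)) ⟩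
    x + (e - η) + η    ≈⟨ +-congʳ (+-congˡ (+-comm e (- η))) ⟩
    x + (- η + e) + η  ≈⟨ +-congʳ (+-assoc x (- η) e) ⟨
    x - η + e + η      ≤⟨ +-monoˡ-≤ _ _ _ (+-monoˡ-≤ _ _ _ (proj₁ x-η<an)) ⟩
    a n + e + η        ≤⟨ +-monoˡ-≤ _ _ _ an+e≤bn ⟩
    b n + η            ∎) (<⇒≱ (begin-strict
    b n + η            <⟨ +-monoˡ-< η bn<y+η ⟩
    y + η + η          ≈⟨ +-assoc y η η ⟩
    y + (η + η)        ≈⟨ +-congˡ η+η≈δ ⟩
    y + δ              ≈⟨ +-comm y δ ⟩
    δ + y              ≈⟨ x-y+y≈x y (x + e) ⟩
    x + e              ∎))
    where
    δ = x + e - y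
    2# = 1# + 1#
    0<2 : 0# < 2#
    0<2 = begin-strict
      0#   <⟨ 0<1 ⟩
      1#   ≤⟨ 1≤1+x (proj₁ 0<1) ⟩
      2#   ∎
    η = δ * 2# ⁻¹
    η>0 : 0# < η
    η>0 = *-pos (x<y⇒0<y-x (≰⇒> ¬p)) (⁻¹-pos 0<2)
    η+η≈δ : η + η ≈ δ
    η+η≈δ = begin-equality
      η + η                  ≈⟨ distribˡ δ _ _ ⟨
      δ * (2# ⁻¹ + 2# ⁻¹)    ≈⟨ *-congˡ (+-cong (*-identityˡ _) (*-identityˡ _)) ⟨
      δ * (1# * 2# ⁻¹ + 1# * 2# ⁻¹)  ≈⟨ *-congˡ (distribʳ _ 1# 1#) ⟨
      δ * (2# * 2# ⁻¹)       ≈⟨ *-congˡ (*-inverse 2# (proj₂ 0<2 ∘ Eq.sym)) ⟩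
      δ * 1#                 ≈⟨ *-identityʳ δ ⟩
      δ                      ∎
    i = proj₁ (a⟶x η η>0)
    j = proj₁ (b⟶y η η>0)
    n = proj₁ (often (i ℕ.⊔ j))
    i⊔j≤n = proj₁ (proj₂ (often (i ℕ.⊔ j)))
    an+e≤bn = proj₂ (proj₂ (often (i ℕ.⊔ j)))
    x-η<an = proj₁ (proj₂ (a⟶x η η>0) n (ℕ.≤-trans (ℕ.m≤m⊔n i j) i⊔j≤n))
    bn<y+η = proj₂ (proj₂ (b⟶y η η>0) n (ℕ.≤-trans (ℕ.m≤n⊔m i j) i⊔j≤n))

  constant-⟶ : ∀ x → (λ _ → x) ⟶ x
  constant-⟶ x η 0<η = 0 , λ _ _ →
    (begin-strict
      x - η      <⟨ +-monoʳ-< x (neg-mono-< 0<η) ⟩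
      x - 0#     ≈⟨ +-identityʳ _ ⟨
      x - 0# + 0#  ≈⟨ x-y+y≈x 0# x ⟩
      x          ∎) ,
    (begin-strict
      x       ≈⟨ +-identityʳ x ⟨
      x + 0#  <⟨ +-monoʳ-< x 0<η ⟩
      x + η   ∎)

  -- The sequence (1 + x/n)^n

  _/ℕ_ : Carrier → ℕ → Carrier
  x /ℕ n = x * (n · 1#) ⁻¹

  compound : Carrier → ℕ → Carrier
  compound x n = (1# + x /ℕ n) ^ n

  /ℕ-nonNeg : ∀ n → 0# ≤ x → 0# ≤ x /ℕ suc n
  /ℕ-nonNeg n 0≤x = *-nonNeg _ _ 0≤x (proj₁ (⁻¹-pos (·1-pos n)))

  ·-/ℕ : ∀ n → suc n · (x /ℕ suc n) ≈ x
  ·-/ℕ {x} n = begin-equality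
    suc n · (x * ν ⁻¹)  ≈⟨ ·≈·1* (suc n) _ ⟩
    ν * (x * ν ⁻¹)      ≈⟨ *-congˡ (*-comm x _) ⟩
    ν * (ν ⁻¹ * x)      ≈⟨ *-assoc ν _ x ⟨
    ν * ν ⁻¹ * x        ≈⟨ *-congʳ (*-inverse ν (proj₂ (·1-pos n) ∘ Eq.sym)) ⟩
    1# * x              ≈⟨ *-identityˡ x ⟩
    x                   ∎
    where ν = suc n · 1#

  ·-/ℕ-* : ∀ m n → suc m · (x /ℕ (suc m ℕ.* suc n)) ≈ x /ℕ suc n
  ·-/ℕ-* {x} m n = ·-cancel n (begin-equality
    suc n · (suc m · u)        ≈⟨ ×-assocˡ u (suc n) (suc m) ⟩
    (suc n ℕ.* suc m) · u      ≈⟨ ×-congˡ (ℕ.*-comm (suc n) (suc m)) ⟩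
    -- The product `suc m ℕ.* suc n` reduces to `suc (n ℕ.+ m ℕ.* suc n)`, whence the argument of
    -- `·-/ℕ`.
    (suc m ℕ.* suc n) · u      ≈⟨ ·-/ℕ (n ℕ.+ m ℕ.* suc n) ⟩
    x                          ≈⟨ ·-/ℕ n ⟨
    suc n · (x /ℕ suc n)       ∎)
    where u = x /ℕ (suc m ℕ.* suc n)

  1+/ℕ : ∀ n → 1# + x /ℕ suc n ≈ (suc n · 1# + x) * (suc n · 1#) ⁻¹
  1+/ℕ {x} n = begin-equality
    1# + x /ℕ suc n        ≈⟨ +-congʳ (*-inverse ν (proj₂ (·1-pos n) ∘ Eq.sym)) ⟨
    ν * ν ⁻¹ + x * ν ⁻¹    ≈⟨ distribʳ (ν ⁻¹) ν x ⟨
    (ν + x) * ν ⁻¹         ∎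
    where ν = suc n · 1#

  1+/ℕ-pos : ∀ n → 0# < suc n · 1# + x → 0# < 1# + x /ℕ suc n
  1+/ℕ-pos {x} n p = begin-strict
    0#                                  <⟨ *-pos p (⁻¹-pos (·1-pos n)) ⟩
    (suc n · 1# + x) * (suc n · 1#) ⁻¹  ≈⟨ 1+/ℕ n ⟨
    1# + x /ℕ suc n                     ∎

  -- Fixes an index N = `suc n` beyond `- x`, so that the bases at N and at all its multiples are
  -- positive.
  module _ {x} n (n+x>0 : 0# < suc n · 1# + x) where

    1+/ℕ-*-pos : ∀ m → 0# < 1# + x /ℕ (suc m ℕ.* suc n)
    1+/ℕ-*-pos m = 1+/ℕ-pos (n ℕ.+ m ℕ.* suc n) (begin-strict
      0#                              <⟨ n+x>0 ⟩
      suc n · 1# + x                  ≤⟨ +-monoˡ-≤ _ _ _ (·1-mono-≤ (ℕ.m≤m+n (suc n) (m ℕ.* suc n))) ⟩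
      (suc m ℕ.* suc n) · 1# + x      ∎)

    compound-pos : 0# < compound x (suc n)
    compound-pos = ^-pos (suc n) (1+/ℕ-pos n n+x>0)

    -- The exponent is split as m N, with Bernoulli's inequality applied to the
    -- power m only; compound x N is then a positive lower bound for exp x.
    compound-mono : ∀ m → compound x (suc n) ≤ compound x (suc m ℕ.* suc n)
    compound-mono m = begin
      (1# + x /ℕ suc n) ^ suc n                    ≈⟨ ^-congˡ (suc n) (+-congˡ (·-/ℕ-* m n)) ⟨
      (1# + suc m · u) ^ suc n                     ≤⟨ ^-mono-≤ (suc n) 0≤ (bernoulli (suc m) (proj₁ (1+/ℕ-*-pos m))) ⟩
      ((1# + u) ^ suc m) ^ suc n                   ≈⟨ ^-assocʳ (1# + u) (suc m) (suc n) ⟩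
      (1# + u) ^ (suc m ℕ.* suc n)                 ∎
      where
      u = x /ℕ (suc m ℕ.* suc n)
      0≤ : 0# ≤ 1# + suc m · u
      0≤ = ≤-respʳ (+-congˡ (Eq.sym (·-/ℕ-* m n))) (proj₁ (1+/ℕ-pos n n+x>0))

  -- Provides the multiple of N beyond a prescribed index that `Frequently` asks for.
  m≤[1+m]*[1+n] : ∀ m n → m ℕ.≤ suc m ℕ.* suc n
  m≤[1+m]*[1+n] m n = ℕ.≤-trans (ℕ.n≤1+n m) (ℕ.m≤m*n (suc m) (suc n))

  -- Positivity and monotonicity of exp

  exp-pos : ∀ x → 0# < exp x
  exp-pos x = ≰⇒> λ exp≤0 → ¬¬-large x λ (n , n+x>0) →
    <⇒≱ (compound-pos n n+x>0) (begin
      compound x (suc n)       ≈⟨ +-identityˡ _ ⟨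
      -- The approximants at multiples of N are compared with the constant sequence `0#`, the gap
      -- being `compound x (suc n)`.
      0# + compound x (suc n)  ≤⟨ ⟶-mono-≤ _ (constant-⟶ 0#) (exp-lim x) (λ m →
                                    suc m ℕ.* suc n , m≤[1+m]*[1+n] m n ,
                                    ≤-respˡ (Eq.sym (+-identityˡ _)) (compound-mono n n+x>0 m)) ⟩
      exp x                    ≤⟨ exp≤0 ⟩
      0#                       ∎)

  -- Powers preserve the order of non-negative bases, and along the multiples of a large N the bases
  -- are positive.
  exp-mono-≤ : x ≤ y → exp x ≤ exp y
  exp-mono-≤ {x} {y} x≤y with exp x ≤? exp y
  ... | yes p = p
  ... | no ¬p = contradiction (λ (n , n+x>0) → ¬p (begin
      exp x       ≈⟨ +-identityʳ _ ⟨
      exp x + 0#  ≤⟨ ⟶-mono-≤ 0# (exp-lim x) (exp-lim y) (λ m →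
                       suc m ℕ.* suc n , m≤[1+m]*[1+n] m n ,
                       ≤-respˡ (Eq.sym (+-identityʳ _))
                         (^-mono-≤ (suc m ℕ.* suc n) (proj₁ (1+/ℕ-*-pos n n+x>0 m))
                           (+-monoʳ-≤ 1# (*-monoʳ-≤ (proj₁ (⁻¹-pos (·1-pos (n ℕ.+ m ℕ.* suc n)))) x≤y)))) ⟩
      exp y       ∎)) (¬¬-large x)

  -- Congruence is not among the axioms for `exp`; it follows from monotonicity and antisymmetry.
  exp-cong : x ≈ y → exp x ≈ exp y
  exp-cong x≈y = antisym (exp-mono-≤ (reflexive x≈y)) (exp-mono-≤ (reflexive (Eq.sym x≈y)))

  -- For x ≤ 0 the base a = 1 + x/n is at most 1, so 1 + y/n ≥ a (1 + (y - x)/n)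
  -- and Bernoulli's inequality gives a gap of aⁿ (y - x).
  compound-gap : ∀ n → x ≤ 0# → x ≤ y → 0# ≤ 1# + x /ℕ suc n →
                 compound x (suc n) * (1# + (y - x)) ≤ compound y (suc n)
  compound-gap {x} {y} n x≤0 x≤y 0≤a = begin
    a ^ k * (1# + h)             ≈⟨ *-congˡ (+-congˡ (·-/ℕ n)) ⟨
    a ^ k * (1# + k · (h /ℕ k))  ≤⟨ *-monoˡ-≤ (^-nonNeg k 0≤a) (bernoulli k 0≤1+h/k) ⟩
    a ^ k * (1# + h /ℕ k) ^ k    ≈⟨ ^-distrib-* a (1# + h /ℕ k) k ⟨
    (a * (1# + h /ℕ k)) ^ k      ≤⟨ ^-mono-≤ k (*-nonNeg _ _ 0≤a 0≤1+h/k) base≤ ⟩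
    (1# + y /ℕ k) ^ k            ∎
    where
    k = suc n
    h = y - x
    a = 1# + x /ℕ k
    0≤h/k : 0# ≤ h /ℕ k
    0≤h/k = /ℕ-nonNeg n (x≤y⇒0≤y-x x≤y)
    0≤1+h/k : 0# ≤ 1# + h /ℕ k
    0≤1+h/k = ≤-trans (proj₁ 0<1) (1≤1+x 0≤h/k)
    a≤1 : a ≤ 1#
    a≤1 = begin
      1# + x /ℕ k   ≤⟨ +-monoʳ-≤ 1# (*-monoʳ-≤ (proj₁ (⁻¹-pos (·1-pos n))) x≤0) ⟩
      1# + 0# /ℕ k  ≈⟨ +-congˡ (zeroˡ _) ⟩
      1# + 0#       ≈⟨ +-identityʳ 1# ⟩
      1#            ∎
    base≤ : a * (1# + h /ℕ k) ≤ 1# + y /ℕ k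
    base≤ = begin
      a * (1# + h /ℕ k)          ≈⟨ distribˡ a 1# _ ⟩
      a * 1# + a * (h /ℕ k)      ≤⟨ +-mono-≤ (reflexive (*-identityʳ a)) (*-monoʳ-≤ 0≤h/k a≤1) ⟩
      a + 1# * (h /ℕ k)          ≈⟨ +-congˡ (*-identityˡ _) ⟩
      1# + x /ℕ k + h /ℕ k       ≈⟨ +-assoc 1# _ _ ⟩
      1# + (x /ℕ k + h /ℕ k)     ≈⟨ +-congˡ (distribʳ _ x h) ⟨
      1# + (x + h) /ℕ k          ≈⟨ +-congˡ (*-congʳ (Eq.trans (+-comm x h) (x-y+y≈x x y))) ⟩
      1# + y /ℕ k                ∎

  -- Along the multiples of N the gap from `compound-gap` is at least `c * h`, a positive number
  -- independent of `m`, so it survives in the limit. The case `x ≤ 0#` covers the arguments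
  -- `- d x y` of the linkage function.
  exp-mono-< : x ≤ 0# → x < y → exp x < exp y
  exp-mono-< {x} {y} x≤0 x<y = ≰⇒> λ exp≥ → ¬¬-large x λ (n , n+x>0) →
    let c   = compound x (suc n)
        h   = y - x
        h>0 = x<y⇒0<y-x x<y
        gap : ∀ m → compound x (suc m ℕ.* suc n) + c * h ≤ compound y (suc m ℕ.* suc n)
        gap m = begin
          compound x (suc m ℕ.* suc n) + c * h                    ≤⟨ +-monoʳ-≤ _ (*-monoʳ-≤ (proj₁ h>0) (compound-mono n n+x>0 m)) ⟩
          compound x (suc m ℕ.* suc n) + compound x (suc m ℕ.* suc n) * h         ≈⟨ +-congʳ (*-identityʳ _) ⟨
          compound x (suc m ℕ.* suc n) * 1# + compound x (suc m ℕ.* suc n) * h    ≈⟨ distribˡ _ 1# h ⟨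
          compound x (suc m ℕ.* suc n) * (1# + h)                 ≤⟨ compound-gap (n ℕ.+ m ℕ.* suc n) x≤0 (proj₁ x<y) (proj₁ (1+/ℕ-*-pos n n+x>0 m)) ⟩
          compound y (suc m ℕ.* suc n)            ∎
    in <⇒≱ (*-pos (compound-pos n n+x>0) h>0) (+-cancelʳ-≤ (exp x) (begin
      c * h + exp x  ≈⟨ +-comm _ _ ⟩
      exp x + c * h  ≤⟨ ⟶-mono-≤ _ (exp-lim x) (exp-lim y) (λ m → suc m ℕ.* suc n , m≤[1+m]*[1+n] m n , gap m) ⟩
      exp y          ≤⟨ exp≥ ⟩
      exp x          ≈⟨ +-identityˡ _ ⟨
      0# + exp x     ∎))

-- Finite lists and subsets

module _ {A : Set} (_≟_ : DecidableEquality A) where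

  -- The later copy of `x` is what the filter behind the head discards.
  length-deduplicate-∷-< : ∀ {x} xs → x ∈ xs → length (deduplicate _≟_ (x ∷ xs)) ℕ.< length (x ∷ xs)
  length-deduplicate-∷-< {x} xs x∈xs = ℕ.s≤s (ℕ.<-≤-trans
    (filter-notAll (λ y → ¬? (x ≟ y)) (deduplicate _≟_ xs)
      (Any.map (λ x≡y x≢y → x≢y x≡y) (∈-deduplicate⁺ _≟_ x∈xs)))
    (length-deduplicate _≟_ xs))

  -- Serves to show that a merge identifying two blocks lowers the number of blocks.
  length-deduplicate-map-< : ∀ {B : Set} (f : B → A) {x y} xs → x ∈ xs → y ∈ xs → x ≢ y → f x ≡ f y →
                             length (deduplicate _≟_ (map f xs)) ℕ.< length xs
  length-deduplicate-map-< f (z ∷ xs) (here refl) (here refl) x≢y _ = contradiction refl x≢y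
  length-deduplicate-map-< f (z ∷ xs) (here refl) (there y∈)  _ fx≡fy =
    ℕ.<-≤-trans
      (length-deduplicate-∷-< (map f xs) (subst (_∈ map f xs) (sym fx≡fy) (∈-map⁺ f y∈)))
      (ℕ.≤-reflexive (cong suc (length-map f xs)))
  length-deduplicate-map-< f (z ∷ xs) (there x∈) (here refl) _ fx≡fy =
    ℕ.<-≤-trans
      (length-deduplicate-∷-< (map f xs) (subst (_∈ map f xs) fx≡fy (∈-map⁺ f x∈)))
      (ℕ.≤-reflexive (cong suc (length-map f xs)))
  length-deduplicate-map-< f (z ∷ xs) (there x∈) (there y∈) x≢y fx≡fy = ℕ.s≤s (ℕ.≤-<-trans
    (length-filter (λ y → ¬? (f z ≟ y)) (deduplicate _≟_ (map f xs)))
    (length-deduplicate-map-< f xs x∈ y∈ x≢y fx≡fy))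

module _ {A : Set} {P : Pred A 0ℓ} (P? : Decidable P) where

  -- The function `f` is general because `upTo n` is `applyUpTo id n` and its tail applies a shifted
  -- function.
  takeWhile-applyUpTo-holds : ∀ (f : ℕ → A) n {i} → i ℕ.< length (takeWhile P? (applyUpTo f n)) → P (f i)
  takeWhile-applyUpTo-holds f (suc n) {i} i< with P? (f 0)
  takeWhile-applyUpTo-holds f (suc n) {zero}  i<         | yes p = p
  takeWhile-applyUpTo-holds f (suc n) {suc i} (ℕ.s≤s i<) | yes p = takeWhile-applyUpTo-holds (f ∘ suc) n i<

  takeWhile-applyUpTo-stops : ∀ (f : ℕ → A) n → let m = length (takeWhile P? (applyUpTo f n)) in
                              m ≡ n ⊎ ¬ P (f m)
  takeWhile-applyUpTo-stops f zero = inj₁ refl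
  takeWhile-applyUpTo-stops f (suc n) with P? (f 0)
  ... | no ¬p = inj₂ ¬p
  ... | yes p with takeWhile-applyUpTo-stops (f ∘ suc) n
  ...   | inj₁ m≡n = inj₁ (cong suc m≡n)
  ...   | inj₂ ¬q  = inj₂ ¬q

∈-⋃⁺ : ∀ {n} {x : Fin n} {X} Xs → X ∈ Xs → x ∈ˢ X → x ∈ˢ ⋃ Xs
∈-⋃⁺ (X ∷ Xs) (here refl)  x∈X = x∈p∪q⁺ (inj₁ x∈X)
∈-⋃⁺ (X ∷ Xs) (there X∈Xs) x∈X = x∈p∪q⁺ (inj₂ (∈-⋃⁺ Xs X∈Xs x∈X))

∈-⋃⁻ : ∀ {n} {x : Fin n} Xs → x ∈ˢ ⋃ Xs → ∃[ X ] (X ∈ Xs × x ∈ˢ X)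
∈-⋃⁻ []       x∈⊥ = contradiction x∈⊥ ∉⊥
∈-⋃⁻ (X ∷ Xs) x∈  with x∈p∪q⁻ X (⋃ Xs) x∈
... | inj₁ x∈X = X , here refl , x∈X
... | inj₂ x∈⋃ with ∈-⋃⁻ Xs x∈⋃
...   | Y , Y∈Xs , x∈Y = Y , there Y∈Xs , x∈Y

∈-elements⁺ : ∀ {n} {X : Subset n} {x} → x ∈ˢ X → x ∈ elements X
∈-elements⁺ {X = X} {x} = ∈-filter⁺ (_∈? X) (∈-allFin x)

∈-elements⁻ : ∀ {n} {X : Subset n} {x} → x ∈ elements X → x ∈ˢ X
∈-elements⁻ {n} {X} x∈ = proj₂ (∈-filter⁻ (_∈? X) {xs = allFin n} x∈)

-- A second element would make `⁅ x ⁆` a proper subset of `p`.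
∣p∣≤1⇒p≡⁅x⁆ : ∀ {n} {p : Subset n} {x} → x ∈ˢ p → ¬ 1 ℕ.< ∣ p ∣ → p ≡ ⁅ x ⁆
∣p∣≤1⇒p≡⁅x⁆ {p = p} {x} x∈p ∣p∣≯1 = ⊆-antisym p⊆⁅x⁆ ⁅x⁆⊆p
  where
  ⁅x⁆⊆p : ⁅ x ⁆ ⊆ p
  ⁅x⁆⊆p y∈⁅x⁆ = subst (_∈ˢ p) (sym (x∈⁅y⁆⇒x≡y x y∈⁅x⁆)) x∈p
  p⊆⁅x⁆ : p ⊆ ⁅ x ⁆
  p⊆⁅x⁆ {y} y∈p = decidable-stable (y ∈? ⁅ x ⁆) λ y∉⁅x⁆ →
    ∣p∣≯1 (subst (ℕ._< ∣ p ∣) (∣⁅x⁆∣≡1 x) (p⊂q⇒∣p∣<∣q∣ (⁅x⁆⊆p , y , y∈p , y∉⁅x⁆)))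

⁅⁆-injective : ∀ {n} {x y : Fin n} → ⁅ x ⁆ ≡ ⁅ y ⁆ → x ≡ y
⁅⁆-injective {x = x} {y} eq = x∈⁅y⁆⇒x≡y y (subst (x ∈ˢ_) eq (x∈⁅x⁆ x))

-- Extrema of finite lists of reals

module Extremum (ℝ : RealNumbers) where

  open RealNumbers ℝ
  open DecTotalOrder decTotalOrder using (totalOrder) renaming (refl to ≤-refl; trans to ≤-trans)
  private module Ext = Extrema totalOrder

  minimum-≤ : ∀ {x xs} → x ∈ xs → minimum xs ≤ x
  minimum-≤ {xs = x ∷ xs} (here refl) = Ext.min≤⊤ x xs
  minimum-≤ {xs = x ∷ xs} (there y∈)  = All.lookup (Ext.min≤xs x xs) y∈

  -- The argument rules out the empty list, whose `minimum` is a junk value.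
  minimum-∈ : ∀ {x xs} → x ∈ xs → minimum xs ∈ xs
  minimum-∈ {xs = x ∷ xs} _ with Ext.argmin-sel id x xs
  ... | inj₁ eq = here eq
  ... | inj₂ m∈ = there m∈

  maximum-≥ : ∀ {x xs} → x ∈ xs → x ≤ maximum xs
  maximum-≥ {xs = x ∷ xs} (here refl) = Ext.⊥≤max x xs
  maximum-≥ {xs = x ∷ xs} (there y∈)  = All.lookup (Ext.xs≤max x xs) y∈

  -- The condition `0# ≤ b` handles the empty list, which arises from the empty and the full subset.
  maximum-≤ : ∀ {b xs} → 0# ≤ b → (∀ {x} → x ∈ xs → x ≤ b) → maximum xs ≤ b
  maximum-≤ {xs = []}     0≤b _    = 0≤b
  maximum-≤ {xs = x ∷ xs} _   xs≤b = Ext.max≤v⁺ (xs≤b (here refl)) (All.tabulate (xs≤b ∘ there))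

  maximum-< : ∀ {b xs} → 0# < b → (∀ {x} → x ∈ xs → x < b) → maximum xs < b
  maximum-< {xs = []}     0<b _    = 0<b
  maximum-< {xs = x ∷ xs} _   xs<b = Ext.max<v⁺ (xs<b (here refl)) (All.tabulate (xs<b ∘ there))

  maximum-nonNeg : ∀ {xs} → (∀ {x} → x ∈ xs → 0# ≤ x) → 0# ≤ maximum xs
  maximum-nonNeg {[]}     _    = ≤-refl
  maximum-nonNeg {x ∷ xs} 0≤xs = ≤-trans (0≤xs (here refl)) (Ext.⊥≤max x xs)

module Linkage (ℝ : RealNumbers) {n : ℕ} (d : Fin n → Fin n → RealNumbers.Carrier ℝ)
               (isMetric : IsMetric ℝ d) where

  open RealNumbers ℝ
  open DecTotalOrder decTotalOrder using (antisym; reflexive; module Eq)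
    renaming (trans to ≤-trans; ≤-respˡ-≈ to ≤-respˡ)
  open IsGeneralMetric isMetric using (nonNegative; 0⇒≈) renaming (sym to d-sym)
  open Exponential ℝ
  open Extremum ℝ

  private
    δ = maximumLinkage ℝ d
    ℓ = ℓSL ℝ d
    variable
      r s : Carrier
      x y : Fin n
      A B X Y : Subset n
      Π : Partition ℝ d

  -- Closed sets and components of the threshold graph {d ≤ r}

  Path : Carrier → Fin n → Fin n → Set
  Path r = Star (λ x y → d x y ≤ r)

  Closed : Carrier → Subset n → Set
  Closed r X = ∀ {x y} → x ∈ˢ X → d x y ≤ r → y ∈ˢ X

  d-sym-≤ : d x y ≤ r → d y x ≤ r
  d-sym-≤ {x} {y} = ≤-respˡ (d-sym x y)

  Path-sym : Path r x y → Path r y x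
  Path-sym = Star.reverse d-sym-≤

  Path-mono : s ≤ r → Path s x y → Path r x y
  Path-mono s≤r = Star.map (λ d≤s → ≤-trans d≤s s≤r)

  Closed-Path : Closed r X → Path r x y → x ∈ˢ X → y ∈ˢ X
  Closed-Path cl ε        x∈X = x∈X
  Closed-Path cl (e ◅ es) x∈X = Closed-Path cl es (cl x∈X e)

  Closed-⊤ : Closed r ⊤
  Closed-⊤ _ _ = ∈⊤

  Closed-∁ : Closed r X → Closed r (∁ X)
  Closed-∁ cl x∈∁X d≤r = x∉p⇒x∈∁p λ y∈X → x∈∁p⇒x∉p x∈∁X (cl y∈X (d-sym-≤ d≤r))

  Closed-∩ : Closed r X → Closed r Y → Closed r (X ∩ Y)
  Closed-∩ {X = X} {Y} clX clY x∈X∩Y d≤r with x∈p∩q⁻ X Y x∈X∩Y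
  ... | x∈X , x∈Y = x∈p∩q⁺ (clX x∈X d≤r , clY x∈Y d≤r)

  -- Maximum linkage

  ∈-crossing : ∀ X {v} →
               v ∈ map (λ (x , x′) → exp (- d x x′)) (cartesianProduct (elements X) (elements (∁ X))) →
               ∃[ x ] ∃[ y ] (x ∈ˢ X × y ∈ˢ ∁ X × v ≡ exp (- d x y))
  ∈-crossing X v∈ with ∈-map⁻ _ v∈
  ... | (x , y) , xy∈ , refl with ∈-cartesianProduct⁻ (elements X) (elements (∁ X)) xy∈
  ...   | x∈ , y∈ = x , y , ∈-elements⁻ x∈ , ∈-elements⁻ y∈ , refl

  δ-≥ : x ∈ˢ X → y ∈ˢ ∁ X → exp (- d x y) ≤ δ X
  δ-≥ x∈X y∈∁X = maximum-≥ (∈-map⁺ _ (∈-cartesianProduct⁺ (∈-elements⁺ x∈X) (∈-elements⁺ y∈∁X)))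

  δ-nonNeg : ∀ X → 0# ≤ δ X
  δ-nonNeg X = maximum-nonNeg λ v∈ → let x , y , _ , _ , eq = ∈-crossing X v∈ in
    subst (0# ≤_) (sym eq) (proj₁ (exp-pos _))

  δ-∁-≤ : ∀ X → δ X ≤ δ (∁ X)
  δ-∁-≤ X = maximum-≤ (δ-nonNeg (∁ X)) λ v∈ → let x , y , x∈X , y∈∁X , eq = ∈-crossing X v∈ in
    subst (_≤ δ (∁ X)) (sym eq)
      (≤-trans (exp-mono-≤ (neg-mono-≤ (reflexive (d-sym y x))))
               (δ-≥ y∈∁X (x∉p⇒x∈∁p (x∈p⇒x∉∁p x∈X))))

  ∁-involutive : ∀ (X : Subset n) → ∁ (∁ X) ≡ X
  ∁-involutive X = ⊆-antisym (λ x∈ → x∉∁p⇒x∈p (x∈∁p⇒x∉p x∈)) (λ x∈ → x∉p⇒x∈∁p (x∈p⇒x∉∁p x∈))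

  δ-symmetric : ∀ X → δ X ≈ δ (∁ X)
  δ-symmetric X = antisym (δ-∁-≤ X) (subst (λ Y → δ (∁ X) ≤ δ Y) (∁-involutive X) (δ-∁-≤ (∁ X)))

  -- A pair at distance at most `r` leaving `X` would contribute a value of at least `exp (- r)` to
  -- the maximum.
  δ<⇒Closed : δ X < exp (- r) → Closed r X
  δ<⇒Closed {X} δ< {x} {y} x∈X d≤r = x∉∁p⇒x∈p λ y∈∁X →
    <⇒≱ δ< (≤-trans (exp-mono-≤ (neg-mono-≤ d≤r)) (δ-≥ x∈X y∈∁X))

  -- All crossing distances exceed `r`, and a maximum over finitely many pairs keeps the strict
  -- bound. Here `r` may be negative, which `threshold-nonNeg` relies on.
  Closed⇒δ< : Closed r X → δ X < exp (- r)
  Closed⇒δ< {r} {X} cl = maximum-< (exp-pos _) λ v∈ → let x , y , x∈X , y∈∁X , eq = ∈-crossing X v∈ in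
    subst (_< exp (- r)) (sym eq)
      (exp-mono-< (-x≤0 nonNegative) (neg-mono-< (≰⇒> λ d≤r → x∈∁p⇒x∉p y∈∁X (cl x∈X d≤r))))

  -- Single linkage

  ℓ-≤ : x ∈ˢ A → y ∈ˢ B → ℓ A B ≤ d x y
  ℓ-≤ x∈A y∈B = minimum-≤ (∈-map⁺ _ (∈-cartesianProduct⁺ (∈-elements⁺ x∈A) (∈-elements⁺ y∈B)))

  ℓ-attained : Nonempty A → Nonempty B → ∃[ x ] ∃[ y ] (x ∈ˢ A × y ∈ˢ B × ℓ A B ≡ d x y)
  ℓ-attained {A} {B} (a , a∈A) (b , b∈B)
    with ∈-map⁻ _ (minimum-∈ (∈-map⁺ (λ (a , b) → d a b) (∈-cartesianProduct⁺ (∈-elements⁺ a∈A) (∈-elements⁺ b∈B))))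
  ... | (x , y) , xy∈ , eq with ∈-cartesianProduct⁻ (elements A) (elements B) xy∈
  ...   | x∈ , y∈ = x , y , ∈-elements⁻ x∈ , ∈-elements⁻ y∈ , eq

  ∈-distinctPairs : A ∈ Π → B ∈ Π → A ≢ B →
                    (A , B) ∈ filter (λ (B , B′) → ¬? (B ≟ˢ B′)) (cartesianProduct Π Π)
  ∈-distinctPairs A∈Π B∈Π A≢B = ∈-filter⁺ (λ (B , B′) → ¬? (B ≟ˢ B′)) (∈-cartesianProduct⁺ A∈Π B∈Π) A≢B

  nextDistance-≤ : A ∈ Π → B ∈ Π → A ≢ B → nextDistance ℝ d Π ≤ ℓ A B
  nextDistance-≤ A∈Π B∈Π A≢B = minimum-≤ (∈-map⁺ _ (∈-distinctPairs A∈Π B∈Π A≢B))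

  nextDistance-attained : A ∈ Π → B ∈ Π → A ≢ B →
                          ∃[ A′ ] ∃[ B′ ] (A′ ∈ Π × B′ ∈ Π × A′ ≢ B′ × nextDistance ℝ d Π ≡ ℓ A′ B′)
  nextDistance-attained {Π = Π} A∈Π B∈Π A≢B
    with ∈-map⁻ _ (minimum-∈ (∈-map⁺ (λ (B , B′) → ℓ B B′) (∈-distinctPairs A∈Π B∈Π A≢B)))
  ... | (A′ , B′) , AB∈ , eq with ∈-filter⁻ (λ (B , B′) → ¬? (B ≟ˢ B′)) {xs = cartesianProduct Π Π} AB∈
  ...   | AB∈′ , A′≢B′ with ∈-cartesianProduct⁻ Π Π AB∈′
  ...     | A′∈ , B′∈ = A′ , B′ , A′∈ , B′∈ , A′≢B′ , eq

  -- Disjointness of the blocks is derived in `overlap⇒≡`; that the list has no repetitions is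
  -- recorded separately by `Unique`.
  record IsComponents (r : Carrier) (Π : Partition ℝ d) : Set where
    field
      nonempty  : A ∈ Π → Nonempty A
      cover     : ∀ x → ∃[ A ] (A ∈ Π × x ∈ˢ A)
      connected : A ∈ Π → x ∈ˢ A → y ∈ˢ A → Path r x y
      closed    : A ∈ Π → Closed r A

    -- A connected set that meets a closed set lies inside it.
    overlap⇒≡ : A ∈ Π → B ∈ Π → x ∈ˢ A → x ∈ˢ B → A ≡ B
    overlap⇒≡ A∈Π B∈Π x∈A x∈B = ⊆-antisym
      (λ y∈A → Closed-Path (closed B∈Π) (connected A∈Π x∈A y∈A) x∈B)
      (λ y∈B → Closed-Path (closed A∈Π) (connected B∈Π x∈B y∈B) x∈A)

  -- Raising the threshold and merging blocks

  module _ {s Π} (components : IsComponents s Π) where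

    open IsComponents components

    components-mono : s ≤ r → (∀ {A B x y} → A ∈ Π → B ∈ Π → A ≢ B → x ∈ˢ A → y ∈ˢ B → ¬ d x y ≤ r) →
                      IsComponents r Π
    components-mono {r} s≤r apart = record
      { nonempty  = nonempty
      ; cover     = cover
      ; connected = λ A∈Π x∈A y∈A → Path-mono s≤r (connected A∈Π x∈A y∈A)
      ; closed    = closed′
      }
      where
      closed′ : A ∈ Π → Closed r A
      closed′ {A} A∈Π {x} {y} x∈A d≤r with cover y
      ... | B , B∈Π , y∈B with A ≟ˢ B
      ...   | yes refl = y∈B
      ...   | no A≢B   = contradiction d≤r (apart A∈Π B∈Π A≢B x∈A y∈B)

    -- The minimum is attained by points of two distinct blocks; at distance at most `s`, closedness
    -- would make these blocks overlap.
    threshold<nextDistance : A ∈ Π → B ∈ Π → A ≢ B → s < nextDistance ℝ d Π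
    threshold<nextDistance A∈Π B∈Π A≢B with nextDistance-attained A∈Π B∈Π A≢B
    ... | A′ , B′ , A′∈ , B′∈ , A′≢B′ , eq with ℓ-attained (nonempty A′∈) (nonempty B′∈)
    ...   | x , y , x∈A′ , y∈B′ , eq′ = subst (s <_) (sym (trans eq eq′))
              (≰⇒> λ d≤s → A′≢B′ (overlap⇒≡ A′∈ B′∈ (closed A′∈ x∈A′ d≤s) y∈B′))

    module Merging (s≤r : s ≤ r) where

      chainUnion : Subset n → Subset n
      chainUnion A = ⋃ (filter (chain? ℝ d r Π A) Π)

      ∈-chainUnion⁺ : B ∈ Π → Chain ℝ d r Π A B → x ∈ˢ B → x ∈ˢ chainUnion A
      ∈-chainUnion⁺ {A = A} B∈Π A~B x∈B = ∈-⋃⁺ _ (∈-filter⁺ (chain? ℝ d r Π A) B∈Π A~B) x∈B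

      ∈-chainUnion⁻ : x ∈ˢ chainUnion A → ∃[ B ] (B ∈ Π × Chain ℝ d r Π A B × x ∈ˢ B)
      ∈-chainUnion⁻ {A = A} x∈ with ∈-⋃⁻ (filter (chain? ℝ d r Π A) Π) x∈
      ... | B , B∈ , x∈B with ∈-filter⁻ (chain? ℝ d r Π A) {xs = Π} B∈
      ...   | B∈Π , A~B = B , B∈Π , A~B , x∈B

      chainUnion-∈-merge : A ∈ Π → chainUnion A ∈ merge ℝ d r Π
      chainUnion-∈-merge A∈Π = ∈-deduplicate⁺ _≟ˢ_ (∈-map⁺ chainUnion A∈Π)

      ∈-merge⁻ : A ∈ merge ℝ d r Π → ∃[ B ] (B ∈ Π × A ≡ chainUnion B)
      ∈-merge⁻ A∈ = ∈-map⁻ chainUnion (∈-deduplicate⁻ _≟ˢ_ (map chainUnion Π) A∈)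

      -- Each link of the chain yields an edge between a closest pair of points, and connectedness
      -- joins these edges inside the blocks.
      Chain⇒Path : A ∈ Π → Chain ℝ d r Π A B → x ∈ˢ A → y ∈ˢ B → Path r x y
      Chain⇒Path A∈Π ε x∈A y∈B = Path-mono s≤r (connected A∈Π x∈A y∈B)
      Chain⇒Path A∈Π ((_ , C∈Π , ℓ≤r) ◅ C~B) x∈A y∈B with ℓ-attained (nonempty A∈Π) (nonempty C∈Π)
      ... | a , c , a∈A , c∈C , eq =
        Path-mono s≤r (connected A∈Π x∈A a∈A) ◅◅ subst (_≤ r) eq ℓ≤r ◅ Chain⇒Path C∈Π C~B c∈C y∈B

      merge-components : IsComponents r (merge ℝ d r Π)
      merge-components = record
        { nonempty  = nonempty′
        ; cover     = cover′
        ; connected = connected′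
        ; closed    = closed′
        }
        where
        nonempty′ : A ∈ merge ℝ d r Π → Nonempty A
        nonempty′ A∈ with ∈-merge⁻ A∈
        ... | B , B∈Π , refl = let x , x∈B = nonempty B∈Π in x , ∈-chainUnion⁺ B∈Π ε x∈B

        cover′ : ∀ x → ∃[ A ] (A ∈ merge ℝ d r Π × x ∈ˢ A)
        cover′ x with cover x
        ... | B , B∈Π , x∈B = chainUnion B , chainUnion-∈-merge B∈Π , ∈-chainUnion⁺ B∈Π ε x∈B

        connected′ : A ∈ merge ℝ d r Π → x ∈ˢ A → y ∈ˢ A → Path r x y
        connected′ A∈ x∈A y∈A with ∈-merge⁻ A∈
        ... | B , B∈Π , refl with nonempty B∈Π | ∈-chainUnion⁻ x∈A | ∈-chainUnion⁻ y∈A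
        ...   | b , b∈B | C , _ , B~C , x∈C | D , _ , B~D , y∈D =
          Path-sym (Chain⇒Path B∈Π B~C b∈B x∈C) ◅◅ Chain⇒Path B∈Π B~D b∈B y∈D

        closed′ : A ∈ merge ℝ d r Π → Closed r A
        closed′ A∈ {x} {y} x∈A d≤r with ∈-merge⁻ A∈
        ... | B , B∈Π , refl with ∈-chainUnion⁻ x∈A | cover y
        ...   | C , C∈Π , B~C , x∈C | D , D∈Π , y∈D =
          -- The edge from `x` to `y` bounds the linkage of `C` and `D` by `r`, so the chain extends
          -- to `D`.
          ∈-chainUnion⁺ D∈Π (B~C ◅◅ (C∈Π , D∈Π , ≤-trans (ℓ-≤ x∈C y∈D) d≤r) ◅ ε) y∈D

      -- The unions built from `A` and from `B` share the point `b`, so they are the same merged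
      -- block.
      length-merge-< : A ∈ Π → B ∈ Π → A ≢ B → ℓ A B ≤ r → length (merge ℝ d r Π) ℕ.< length Π
      length-merge-< A∈Π B∈Π A≢B ℓ≤r with nonempty B∈Π
      ... | b , b∈B = length-deduplicate-map-< _≟ˢ_ chainUnion Π A∈Π B∈Π A≢B
        (IsComponents.overlap⇒≡ merge-components (chainUnion-∈-merge A∈Π) (chainUnion-∈-merge B∈Π)
          (∈-chainUnion⁺ B∈Π ((A∈Π , B∈Π , ℓ≤r) ◅ ε) b∈B) (∈-chainUnion⁺ B∈Π ε b∈B))

  -- The point of `Fin n` excludes the empty list, a single covering block would be `⊤`, and among
  -- two or more entries the first two differ by uniqueness.
  nontrivial⇒distinct : ∀ Π → IsComponents s Π → Fin n → Unique Π → ¬ IsTrivial ℝ d Π →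
                        ∃[ A ] ∃[ B ] (A ∈ Π × B ∈ Π × A ≢ B)
  nontrivial⇒distinct [] components x₀ _ _ with IsComponents.cover components x₀
  ... | _ , () , _
  nontrivial⇒distinct (A ∷ []) components _ _ nontrivial =
    contradiction (cong (_∷ []) (⊆-antisym ⊆⊤ λ {x} _ → ∈A x)) nontrivial
    where
    ∈A : ∀ x → x ∈ˢ A
    ∈A x with IsComponents.cover components x
    ... | _ , here refl , x∈A = x∈A
  nontrivial⇒distinct (A ∷ B ∷ _) _ _ ((A≢B ∷ _) ∷ _) _ = A , B , here refl , there (here refl) , A≢B

  singletons-components : IsComponents 0# (Θ ℝ d 0)
  singletons-components = record
    { nonempty  = nonempty
    ; cover     = λ x → ⁅ x ⁆ , ∈-map⁺ ⁅_⁆ (∈-allFin x) , x∈⁅x⁆ x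
    ; connected = connected
    ; closed    = closed
    }
    where
    nonempty : A ∈ Θ ℝ d 0 → Nonempty A
    nonempty A∈ with ∈-map⁻ ⁅_⁆ A∈
    ... | x , _ , refl = x , x∈⁅x⁆ x
    connected : A ∈ Θ ℝ d 0 → x ∈ˢ A → y ∈ˢ A → Path 0# x y
    connected A∈ x∈A y∈A with ∈-map⁻ ⁅_⁆ A∈
    ... | z , _ , refl with x∈⁅y⁆⇒x≡y z x∈A | x∈⁅y⁆⇒x≡y z y∈A
    ...   | refl | refl = ε
    closed : A ∈ Θ ℝ d 0 → Closed 0# A
    -- Points at distance at most zero coincide.
    closed _ x∈A d≤0 = subst (_∈ˢ _) (0⇒≈ (antisym d≤0 nonNegative)) x∈A

  -- The successive partitions of the dendrogram

  module Dendrogram (x₀ : Fin n) where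

    -- The field `size` expresses that every step so far removed at least one block; it bounds the
    -- number of steps.
    record Stage (i : ℕ) : Set where
      field
        components : IsComponents (R ℝ d i) (Θ ℝ d i)
        unique     : Unique (Θ ℝ d i)
        size       : length (Θ ℝ d i) ℕ.+ i ℕ.≤ n

    nontrivial : ∀ {i} → i ℕ.< lastIndex ℝ d → ¬ IsTrivial ℝ d (Θ ℝ d i)
    nontrivial = takeWhile-applyUpTo-holds (λ i → ¬? (isTrivial? ℝ d (Θ ℝ d i))) id n

    stage : ∀ i → i ℕ.≤ lastIndex ℝ d → Stage i
    stage zero _ = record
      { components = singletons-components
      ; unique     = Unique.map⁺ ⁅⁆-injective (Unique.allFin⁺ n)
      ; size       = ℕ.≤-reflexive (trans (ℕ.+-identityʳ _) (trans (length-map ⁅_⁆ (allFin n)) (length-tabulate id)))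
      }
    stage (suc i) i<m
      with previous ← stage i (ℕ.<⇒≤ i<m)
      with A , B , A∈ , B∈ , A≢B
        ← nontrivial⇒distinct _ (Stage.components previous) x₀ (Stage.unique previous) (nontrivial i<m)
      -- A closest pair of distinct blocks is linked at the new distance, so the number of blocks
      -- drops.
      with A′ , B′ , A′∈ , B′∈ , A′≢B′ , eq ← nextDistance-attained A∈ B∈ A≢B = record
        { components = merge-components
        ; unique     = deduplicate-! _≟ˢ_ _
        ; size       = ℕ.≤-trans (ℕ.≤-reflexive (ℕ.+-suc _ i))
            (ℕ.≤-trans (ℕ.+-monoˡ-≤ i (length-merge-< A′∈ B′∈ A′≢B′ (reflexive (Eq.reflexive (sym eq))))) size)
        }
      where
      open Stage previous
      open Merging components (proj₁ (threshold<nextDistance components A∈ B∈ A≢B))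

    lastPartition-trivial : IsTrivial ℝ d (Θ ℝ d (lastIndex ℝ d))
    lastPartition-trivial
      with takeWhile-applyUpTo-stops (λ i → ¬? (isTrivial? ℝ d (Θ ℝ d i))) id n
    ... | inj₂ ¬¬trivial = decidable-stable (isTrivial? ℝ d _) ¬¬trivial
    -- If the search exhausted `upTo n`, then `size` would leave room for no block, yet `x₀` lies in
    -- one.
    ... | inj₁ m≡n with IsComponents.cover (Stage.components (stage (lastIndex ℝ d) ℕ.≤-refl)) x₀
    ...   | A , A∈ , _ = contradiction
      (ℕ.≤-trans (ℕ.+-monoˡ-≤ _ (nonempty-length A∈)) (Stage.size (stage (lastIndex ℝ d) ℕ.≤-refl)))
      (subst (λ k → ¬ suc (lastIndex ℝ d) ℕ.≤ k) m≡n (ℕ.<-irrefl refl))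
      where
      nonempty-length : ∀ {Π : Partition ℝ d} {A} → A ∈ Π → 1 ℕ.≤ length Π
      nonempty-length (here _)  = ℕ.s≤s ℕ.z≤n
      nonempty-length (there _) = ℕ.s≤s ℕ.z≤n

    -- The partition at a given distance

    module _ (r : Carrier) (r≥0 : 0# ≤ r) where

      private
        m = lastIndex ℝ d
        i = index ℝ d r
        candidates = filter (λ i → R ℝ d i ≤? r) (upTo (suc m))

      index-candidate : i ℕ.≤ m × R ℝ d i ≤ r
      index-candidate with ℕExtrema.argmax-sel id 0 candidates
      ... | inj₁ i≡0 = subst (λ j → j ℕ.≤ m × R ℝ d j ≤ r) (sym i≡0) (ℕ.z≤n , r≥0)
      ... | inj₂ i∈  with ∈-filter⁻ (λ i → R ℝ d i ≤? r) {xs = upTo (suc m)} i∈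
      ...   | i∈upTo , Ri≤r = ℕ.s≤s⁻¹ (∈-upTo⁻ i∈upTo) , Ri≤r

      -- Otherwise `suc i` would be a candidate above the maximum of the candidates.
      index-maximal : i ℕ.< m → ¬ R ℝ d (suc i) ≤ r
      index-maximal i<m Rsi≤r = ℕ.<-irrefl refl
        (All.lookup (ℕExtrema.xs≤max 0 candidates)
          (∈-filter⁺ (λ i → R ℝ d i ≤? r) (∈-upTo⁺ (ℕ.s≤s i<m)) Rsi≤r))

      dendrogram-components : IsComponents r (dendrogram ℝ d r r≥0)
      dendrogram-components = components-mono (Stage.components (stage i i≤m)) (proj₂ index-candidate) apart
        where
        i≤m = proj₁ index-candidate
        apart : ∀ {A B x y} → A ∈ Θ ℝ d i → B ∈ Θ ℝ d i → A ≢ B → x ∈ˢ A → y ∈ˢ B → ¬ d x y ≤ r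
        apart A∈ B∈ A≢B x∈A y∈B d≤r with ℕ.m≤n⇒m<n∨m≡n i≤m
        -- An edge of length at most `r` between two blocks would bound the next merge distance by
        -- `r`.
        ... | inj₁ i<m = index-maximal i<m (≤-trans (nextDistance-≤ A∈ B∈ A≢B) (≤-trans (ℓ-≤ x∈A y∈B) d≤r))
        -- At the last index there is only one block.
        ... | inj₂ i≡m with trans (cong (Θ ℝ d) i≡m) lastPartition-trivial
        ...   | eq with subst (_ ∈_) eq A∈ | subst (_ ∈_) eq B∈
        ...     | here refl | here refl = A≢B refl

  -- Tangles

  block⇒tangle : IsComponents r Π → B ∈ Π → 1 ℕ.< ∣ B ∣ →
                 IsTangle ℝ δ (exp (- r)) (λ X → (δ X < exp (- r)) × (B ⊆ X))
  block⇒tangle {r} {Π} {B} components B∈Π ∣B∣>1 = record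
    { symmetric = δ-symmetric
    ; k≥0       = proj₁ (exp-pos _)
    ; T0        = λ _ → proj₁
    ; T1        = T1
    ; T2        = λ _ _ _ (_ , B⊆X) (_ , B⊆Y) (_ , B⊆Z) →
                    b , x∈p∩q⁺ (B⊆X b∈B , x∈p∩q⁺ (B⊆Y b∈B , B⊆Z b∈B))
    ; T3        = λ x (_ , B⊆⁅x⁆) →
                    ℕ.<⇒≱ ∣B∣>1 (subst (∣ B ∣ ℕ.≤_) (∣⁅x⁆∣≡1 x) (p⊆q⇒∣p∣≤∣q∣ B⊆⁅x⁆))
    }
    where
    open IsComponents components
    b   = proj₁ (nonempty B∈Π)
    b∈B = proj₂ (nonempty B∈Π)

    block⊆ : Closed r X → b ∈ˢ X → B ⊆ X
    block⊆ cl b∈X y∈B = Closed-Path cl (connected B∈Π b∈B y∈B) b∈X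

    T1 : ∀ X → δ X < exp (- r) →
         ((δ X < exp (- r)) × (B ⊆ X)) ⊎ ((δ (∁ X) < exp (- r)) × (B ⊆ ∁ X))
    -- The point `b` decides: `X` and `∁ X` are both closed, and the connected block follows `b`
    -- into one of them.
    T1 X δ<k with cl ← δ<⇒Closed δ<k with b ∈? X
    ... | yes b∈X = inj₁ (δ<k , block⊆ cl b∈X)
    ... | no b∉X  = inj₂ (Closed⇒δ< (Closed-∁ cl) , block⊆ (Closed-∁ cl) (x∉p⇒x∈∁p b∉X))

  -- The block determined by a tangle

  module _ {k r 𝒯} (tangle : IsTangle ℝ δ k 𝒯) (k≈exp : k ≈ exp (- r)) where

    open IsTangle tangle

    member-closed : 𝒯 X → Closed r X
    member-closed {X} X∈𝒯 = δ<⇒Closed (<-respʳ k≈exp (T0 X X∈𝒯))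

    -- Abstract because with-abstractions below would otherwise normalise its proof.
    abstract
      closed⇒δ<k : ∀ X → Closed r X → δ X < k
      closed⇒δ<k X cl = <-respʳ (Eq.sym k≈exp) (Closed⇒δ< cl)

    members-meet : 𝒯 X → 𝒯 Y → ∃[ x ] (x ∈ˢ X × x ∈ˢ Y)
    members-meet {X} {Y} X∈𝒯 Y∈𝒯 with T2 X Y Y X∈𝒯 Y∈𝒯 Y∈𝒯
    ... | x , x∈ with x∈p∩q⁻ X (Y ∩ Y) x∈
    ...   | x∈X , x∈Y∩Y = x , x∈X , p∩q⊆p Y Y x∈Y∩Y

    ⊤-member : 𝒯 ⊤
    ⊤-member with T1 ⊤ (closed⇒δ<k ⊤ Closed-⊤)
    ... | inj₁ ⊤∈𝒯  = ⊤∈𝒯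
    ... | inj₂ ∁⊤∈𝒯 with members-meet ∁⊤∈𝒯 ∁⊤∈𝒯
    ...   | x , x∈∁⊤ , _ = contradiction ∈⊤ (x∈∁p⇒x∉p x∈∁⊤)

    -- The sets `X`, `Y` and `∁ (X ∩ Y)` have no common point, so `T2` excludes the complement and
    -- `T1` leaves the intersection.
    ∩-member : 𝒯 X → 𝒯 Y → 𝒯 (X ∩ Y)
    ∩-member {X} {Y} X∈𝒯 Y∈𝒯
      with T1 (X ∩ Y) (closed⇒δ<k (X ∩ Y) (Closed-∩ (member-closed X∈𝒯) (member-closed Y∈𝒯)))
    ... | inj₁ X∩Y∈𝒯 = X∩Y∈𝒯
    ... | inj₂ ∁∈𝒯 with T2 X Y (∁ (X ∩ Y)) X∈𝒯 Y∈𝒯 ∁∈𝒯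
    ...   | x , x∈ with x∈p∩q⁻ X (Y ∩ ∁ (X ∩ Y)) x∈
    ...     | x∈X , x∈Y∩∁ with x∈p∩q⁻ Y (∁ (X ∩ Y)) x∈Y∩∁
    ...       | x∈Y , x∈∁ = contradiction (x∈p∩q⁺ (x∈X , x∈Y)) (x∈∁p⇒x∉p x∈∁)

    -- While no block is found in `𝒯`, the complements of the blocks seen are intersected, starting
    -- from `⊤`; the result `D` stays in `𝒯`.
    block-or-avoiding : ∀ Π → (∀ {A} → A ∈ Π → Closed r A) →
                        (∃[ B ] (B ∈ Π × 𝒯 B)) ⊎
                        (∃[ D ] (𝒯 D × (∀ {x A} → x ∈ˢ D → A ∈ Π → x ∉ˢ A)))
    block-or-avoiding [] _ = inj₂ (⊤ , ⊤-member , λ _ ())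
    block-or-avoiding (B ∷ Π) closed
      with T1 B (closed⇒δ<k B (closed (here refl))) | block-or-avoiding Π (closed ∘ there)
    ... | inj₁ B∈𝒯  | _                        = inj₁ (B , here refl , B∈𝒯)
    ... | inj₂ _    | inj₁ (A , A∈Π , A∈𝒯)     = inj₁ (A , there A∈Π , A∈𝒯)
    ... | inj₂ ∁B∈𝒯 | inj₂ (D , D∈𝒯 , avoids)  = inj₂ (∁ B ∩ D , ∩-member ∁B∈𝒯 D∈𝒯 , avoids′)
      where
      avoids′ : ∀ {x A} → x ∈ˢ ∁ B ∩ D → A ∈ B ∷ Π → x ∉ˢ A
      avoids′ x∈ (here refl) = x∈∁p⇒x∉p (p∩q⊆p (∁ B) D x∈)
      avoids′ x∈ (there A∈Π) = avoids (p∩q⊆q (∁ B) D x∈) A∈Π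

    -- A member avoiding all blocks would be empty since they cover everything, but members are
    -- nonempty by `T2`.
    member-block : ∀ Π → (∀ {A} → A ∈ Π → Closed r A) → (∀ x → ∃[ A ] (A ∈ Π × x ∈ˢ A)) →
                   ∃[ B ] (B ∈ Π × 𝒯 B)
    member-block Π closed cover with block-or-avoiding Π closed
    ... | inj₁ found = found
    ... | inj₂ (D , D∈𝒯 , avoids) with members-meet D∈𝒯 D∈𝒯
    ...   | x , x∈D , _ with cover x
    ...     | A , A∈Π , x∈A = contradiction x∈A (avoids x∈D A∈Π)

    -- Below threshold 0 all singletons are closed, so one of them would be in 𝒯.
    threshold-nonNeg : 0# ≤ r
    threshold-nonNeg with 0# ≤? r
    ... | yes r≥0 = r≥0
    ... | no r≱0
      with member-block (Θ ℝ d 0)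
             (λ _ _ d≤r → contradiction (≤-trans nonNegative d≤r) r≱0)
             (IsComponents.cover singletons-components)
    ...   | B , B∈ , B∈𝒯 with ∈-map⁻ ⁅_⁆ B∈
    ...     | x , _ , refl = contradiction B∈𝒯 (T3 x)

    tangle⇒block : IsComponents r Π →
                   ∃[ B ] (B ∈ Π × (1 ℕ.< ∣ B ∣) × (𝒯 ≐ (λ X → (δ X < k) × (B ⊆ X))))
    tangle⇒block components with member-block _ (IsComponents.closed components) (IsComponents.cover components)
    ... | B , B∈Π , B∈𝒯 = B , B∈Π , ∣B∣>1 , (λ X∈𝒯 → T0 _ X∈𝒯 , block⊆ X∈𝒯) , member
      where
      open IsComponents components
      ∣B∣>1 : 1 ℕ.< ∣ B ∣
      ∣B∣>1 = decidable-stable (1 ℕ.<? ∣ B ∣) λ ∣B∣≯1 → let x , x∈B = nonempty B∈Π in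
        T3 x (subst 𝒯 (∣p∣≤1⇒p≡⁅x⁆ x∈B ∣B∣≯1) B∈𝒯)
      block⊆ : 𝒯 X → B ⊆ X
      block⊆ X∈𝒯 y∈B with members-meet B∈𝒯 X∈𝒯
      -- From a common point `z`, the connected block cannot leave the closed set `X`.
      ... | z , z∈B , z∈X = Closed-Path (member-closed X∈𝒯) (connected B∈Π z∈B y∈B) z∈X
      member : ∀ {X} → (δ X < k) × (B ⊆ X) → 𝒯 X
      member {X} (δ<k , B⊆X) with T1 X δ<k
      ... | inj₁ X∈𝒯  = X∈𝒯
      ... | inj₂ ∁X∈𝒯 with members-meet B∈𝒯 ∁X∈𝒯
      ...   | z , z∈B , z∈∁X = contradiction (B⊆X z∈B) (x∈∁p⇒x∉p z∈∁X)

theorem1p2 : (ℝ : RealNumbers) → let open RealNumbers ℝ in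
    (n : ℕ) → .{{_ : NonZero n}} →
    (d : Fin n → Fin n → Carrier) → IsMetric ℝ d →
    let δ = maximumLinkage ℝ d
        θ = dendrogram ℝ d
    in
    (∀ (r : Carrier) (r≥0 : 0# ≤ r) (B : Subset n) → B ∈ θ r r≥0 → 1 ℕ.< ∣ B ∣ →
       IsTangle ℝ δ (exp (- r)) (λ X → (δ X < exp (- r)) × (B ⊆ X)))
    ×
    (∀ (k : Carrier) (k>0 : 0# < k) (𝒯 : Pred (Subset n) 0ℓ) → IsTangle ℝ δ k 𝒯 →
       Σ[ -log≥0 ∈ 0# ≤ - log k k>0 ]
       ∃[ B ] ((B ∈ θ (- log k k>0) -log≥0) × (1 ℕ.< ∣ B ∣) ×
               (𝒯 ≐ (λ X → (δ X < k) × (B ⊆ X)))))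
theorem1p2 ℝ n d isMetric =
  (λ r r≥0 B B∈θ ∣B∣>1 → block⇒tangle (dendrogram-components r r≥0) B∈θ ∣B∣>1) ,
  (λ k k>0 𝒯 tangle →
    -- The threshold is `- log k k>0`, whose negative has exponential `k`.
    let k≈exp  = Eq.trans (Eq.sym (exp-log k k>0)) (exp-cong (Eq.sym (-‿involutive (log k k>0))))
        -log≥0 = threshold-nonNeg tangle k≈exp
    in -log≥0 , tangle⇒block tangle k≈exp (dendrogram-components _ -log≥0))
  where
  open RealNumbers ℝ
  open DecTotalOrder decTotalOrder using (module Eq)
  open RingProperties (CommutativeRing.ring commutativeRing) using (-‿involutive)
  open Exponential ℝ
  open Linkage ℝ d isMetric
  open Dendrogram (fromℕ< (ℕ.>-nonZero⁻¹ n))
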